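{- Let $\mathcal{M}$ be a structure with universe $M$, let $f$ be an $n$-ary functional symbol of its signature, and let $\varphi(x_1,\ldots,x_n,y)$ be the atomic formula $f(x_1,\ldots,x_n)\approx y$. Let $\emptyset\neq P\subseteq M$. Then the tuple $(P_1,\ldots,P_n,Q)=(P,\ldots,P,P)$ is $\varphi$-preserved (i.e. $\varphi$-idempotent) if and only if $P$ is the universe of a subalgebra of the restriction of $\mathcal{M}$ to the signature symbol $f$.
   Context: For a formula $\varphi(x_1,\ldots,x_n,y)$ and $a_1,\ldots,a_n\in M$, $\varphi(a_1,\ldots,a_n,\mathcal{M})=\{b\in M\mid \mathcal{M}\models\varphi(a_1,\ldots,a_n,b)\}$. For $P_1,\ldots,P_n,Q\subseteq M$ the tuple $(P_1,\ldots,P_n,Q)$ is (totally) $\varphi$-preserved if $\varphi(a_1,\ldots,a_n,\mathcal{M})\subseteq Q$ for all $a_1\in P_1,\ldots,a_n\in P_n$. If moreover $P_1=\ldots=P_n=Q$, the $\varphi$-preserved tuple is called $\varphi$-idempotent. -}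

module Defs where

open import Level using (Level; _⊔_) renaming (suc to lsuc)
open import Data.Nat using (ℕ; suc)
open import Data.Fin using (Fin; inject₁; fromℕ)
open import Data.Vec using (Vec; []; _∷_; _∷ʳ_; lookup; map; tabulate)
open import Data.Product using (Σ; ∃; ∃-syntax; _×_; proj₁)
open import Data.Sum using (_⊎_)
open import Data.Empty.Polymorphic using (⊥)
open import Function.Bundles using (_⇔_)
open import Relation.Unary using (Pred; _∈_; _⊆_; _≐_; Satisfiable)
open import Relation.Binary.PropositionalEquality using (_≡_)

private variable
  s a p : Level
  n : ℕ

-- Symbols are indexed by their arity.
record Signature (s : Level) : Set (lsuc s) where
  field
    FunSym : ℕ → Set s
    RelSym : ℕ → Set s

open Signature public

record Structure (S : Signature s) (a : Level) : Set (s ⊔ lsuc a) where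
  field
    Universe : Set a
    fun : ∀ {n} → FunSym S n → Vec Universe n → Universe
    rel : ∀ {n} → RelSym S n → Vec Universe n → Set a

open Structure public

-- `Term S n` and `Formula S n` have their free variables among n variables.
data Term (S : Signature s) (n : ℕ) : Set s where
  var : Fin n → Term S n
  app : ∀ {k} → FunSym S k → Vec (Term S n) k → Term S n

-- Quantifiers bind variable zero; the other variables are shifted by one.
data Formula (S : Signature s) : ℕ → Set s where
  _≈′_ : Term S n → Term S n → Formula S n
  atom : ∀ {k} → RelSym S k → Vec (Term S n) k → Formula S n
  ⊥′ : Formula S n
  _∧′_ _∨′_ _⇒′_ : Formula S n → Formula S n → Formula S n
  ∀′ ∃′ : Formula S (suc n) → Formula S n

module _ {S : Signature s} (M : Structure S a) where

  mutual
    eval : Vec (Universe M) n → Term S n → Universe M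
    eval ρ (var i) = lookup ρ i
    eval ρ (app f ts) = fun M f (evals ρ ts)

    evals : ∀ {k} → Vec (Universe M) n → Vec (Term S n) k → Vec (Universe M) k
    evals ρ [] = []
    evals ρ (t ∷ ts) = eval ρ t ∷ evals ρ ts

  -- Satisfaction reads the connectives as those of Agda; negation is φ ⇒′ ⊥′.
  Sat : Formula S n → Vec (Universe M) n → Set a
  Sat (t ≈′ u) ρ = eval ρ t ≡ eval ρ u
  Sat (atom R ts) ρ = rel M R (evals ρ ts)
  Sat ⊥′ ρ = ⊥
  Sat (φ ∧′ ψ) ρ = Sat φ ρ × Sat ψ ρ
  Sat (φ ∨′ ψ) ρ = Sat φ ρ ⊎ Sat ψ ρ
  Sat (φ ⇒′ ψ) ρ = Sat φ ρ → Sat ψ ρ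
  Sat (∀′ φ) ρ = ∀ m → Sat φ (m ∷ ρ)
  Sat (∃′ φ) ρ = ∃[ m ] Sat φ (m ∷ ρ)

  -- In a formula φ(x₁,…,xₙ,y) the variable y is the last of the n + 1 variables.
  -- This is the set φ(a₁,…,aₙ,M).
  Image : Formula S (suc n) → Vec (Universe M) n → Pred (Universe M) a
  Image φ as b = Sat φ (as ∷ʳ b)

  Preserved : Formula S (suc n) → (Fin n → Pred (Universe M) p) → Pred (Universe M) p →
              Set (a ⊔ p)
  Preserved {n = n} φ Ps Q =
    (as : Vec (Universe M) n) → (∀ i → lookup as i ∈ Ps i) → Image φ as ⊆ Q

  Idempotent : Formula S (suc n) → (Fin n → Pred (Universe M) p) → Pred (Universe M) p →
               Set (a ⊔ p)
  Idempotent φ Ps Q = Preserved φ Ps Q × (∀ i → Ps i ≐ Q)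

-- f(x₁,…,xₙ) ≈ y
graphFormula : {S : Signature s} → FunSym S n → Formula S (suc n)
graphFormula {n = n} f = app f (tabulate (λ i → var (inject₁ i))) ≈′ var (fromℕ n)

data Only {S : Signature s} (f : FunSym S n) : ℕ → Set s where
  only : Only {S = S} f n

singleton : (S : Signature s) → FunSym S n → Signature s
singleton S f = record { FunSym = Only {S = S} f ; RelSym = λ _ → ⊥ }

-- The restriction of M to the symbol f. It has no relations, so it is an algebra
-- and its substructures are its subalgebras.
restriction : {S : Signature s} (M : Structure S a) (f : FunSym S n) →
              Structure (singleton S f) a
restriction M f = record
  { Universe = Universe M
  ; fun = λ { only → fun M f }
  ; rel = λ ()
  }

-- A nonempty subset B of the universe of M together with operations and relations
-- on B that are the restrictions of those of M. Elements of Σ _ B carry a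
-- membership proof, so they are compared through their first projections.
record Substructure {S : Signature s} (M : Structure S a) (p : Level) :
                    Set (s ⊔ lsuc (a ⊔ p)) where
  field
    subset : Pred (Universe M) p
    nonempty : Satisfiable subset
    subfun : ∀ {n} → FunSym S n → Vec (Σ (Universe M) subset) n → Σ (Universe M) subset
    subrel : ∀ {n} → RelSym S n → Vec (Σ (Universe M) subset) n → Set (a ⊔ p)
    subfun-restricts : ∀ {n} (f : FunSym S n) bs →
                       proj₁ (subfun f bs) ≡ fun M f (map proj₁ bs)
    subrel-restricts : ∀ {n} (R : RelSym S n) bs →
                       subrel R bs ⇔ rel M R (map proj₁ bs)

  structure : Structure S (a ⊔ p)
  structure = record { Universe = Σ (Universe M) subset ; fun = subfun ; rel = subrel }

open Substructure public

IsUniverseOfSubstructure : {S : Signature s} (M : Structure S a) →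
                           Pred (Universe M) p → Set (s ⊔ lsuc (a ⊔ p))
IsUniverseOfSubstructure {p = p} M P = ∃[ B ] subset {M = M} {p = p} B ≐ P

{-# OPTIONS --safe #-}
module Submission where

open import Defs
open import Level using (Level; _⊔_)
open import Data.Nat using (ℕ; zero; suc)
open import Data.Fin using (Fin; inject₁; fromℕ; zero; suc)
open import Data.Vec using (Vec; []; _∷_; _∷ʳ_; lookup; map; tabulate)
open import Data.Vec.Properties
  using (lookup-map; tabulate-∘; tabulate∘lookup; tabulate-cong)
open import Data.Product using (Σ; _×_; _,_; proj₁; proj₂)
open import Function.Base using (const; _∘_)
open import Function.Bundles using (_⇔_; mk⇔; Equivalence)
open import Function.Construct.Composition using (_⇔-∘_)
open import Function.Construct.Symmetry using (⇔-sym)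
open import Relation.Unary using (Pred; Satisfiable; _∈_)
open import Relation.Unary.Properties using (≐-refl)
open import Relation.Binary.PropositionalEquality
  using (_≡_; refl; sym; trans; cong; subst; module ≡-Reasoning)

private variable
  s a p : Level
  A : Set a
  n k : ℕ

-- For a tuple `as` the set defined by the graph formula is the single point `fun M f as`, so being
-- preserved says exactly that `P` is closed under the operation `f` (`preserved⇔closed`). A
-- nonempty set closed under the only operation of the restriction carries a subalgebra, and
-- conversely the operation of a subalgebra keeps its values in the universe (`closed⇔subuniverse`).
-- Both equivalences of the theorem pass through `Closed`.

lookup-∷ʳ-inject₁ : (xs : Vec A n) (x : A) (i : Fin n) →
                    lookup (xs ∷ʳ x) (inject₁ i) ≡ lookup xs i
lookup-∷ʳ-inject₁ (y ∷ xs) x zero    = refl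
lookup-∷ʳ-inject₁ (y ∷ xs) x (suc i) = lookup-∷ʳ-inject₁ xs x i

lookup-∷ʳ-fromℕ : (xs : Vec A n) (x : A) → lookup (xs ∷ʳ x) (fromℕ n) ≡ x
lookup-∷ʳ-fromℕ []       x = refl
lookup-∷ʳ-fromℕ (y ∷ xs) x = lookup-∷ʳ-fromℕ xs x

-- Operations of a substructure act on elements paired with membership proofs; this turns a tuple of
-- `P` into an argument for them.
attach : {P : Pred A p} (xs : Vec A n) → (∀ i → lookup xs i ∈ P) → Vec (Σ A P) n
attach xs xs∈P = tabulate (λ i → lookup xs i , xs∈P i)

map-proj₁-attach : {P : Pred A p} (xs : Vec A n) (xs∈P : ∀ i → lookup xs i ∈ P) →
                   map proj₁ (attach {P = P} xs xs∈P) ≡ xs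
map-proj₁-attach xs xs∈P = trans (sym (tabulate-∘ proj₁ _)) (tabulate∘lookup xs)

lookup-map-proj₁-∈ : {P : Pred A p} (bs : Vec (Σ A P) n) →
                     ∀ i → lookup (map proj₁ bs) i ∈ P
lookup-map-proj₁-∈ {P = P} bs i =
  subst P (sym (lookup-map i proj₁ bs)) (proj₂ (lookup bs i))

Closed : {S : Signature s} (M : Structure S a) → FunSym S n → Pred (Universe M) p → Set (a ⊔ p)
Closed M f P = ∀ as → (∀ i → lookup as i ∈ P) → fun M f as ∈ P

module _ {S : Signature s} (M : Structure S a) where

  -- An arbitrary `g` makes the induction on `k` work: the tail of the tabulated vector is the same
  -- statement for `g ∘ suc`.
  evals-tabulate-var : (ρ : Vec (Universe M) n) (g : Fin k → Fin n) →
                       evals M ρ (tabulate (var ∘ g)) ≡ tabulate (lookup ρ ∘ g)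
  evals-tabulate-var {k = zero}  ρ g = refl
  evals-tabulate-var {k = suc k} ρ g = cong (lookup ρ (g zero) ∷_) (evals-tabulate-var ρ (g ∘ suc))

  evals-initial-vars : (as : Vec (Universe M) n) (b : Universe M) →
                       evals M (as ∷ʳ b) (tabulate (var ∘ inject₁)) ≡ as
  evals-initial-vars as b = begin
    evals M (as ∷ʳ b) (tabulate (var ∘ inject₁))  ≡⟨ evals-tabulate-var (as ∷ʳ b) inject₁ ⟩
    tabulate (lookup (as ∷ʳ b) ∘ inject₁)         ≡⟨ tabulate-cong (lookup-∷ʳ-inject₁ as b) ⟩
    tabulate (lookup as)                          ≡⟨ tabulate∘lookup as ⟩
    as                                            ∎
    where open ≡-Reasoning

  module _ (f : FunSym S n) where

    Image-graph : ∀ as b → b ∈ Image M (graphFormula {S = S} f) as ⇔ fun M f as ≡ b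
    Image-graph as b = mk⇔
      (λ eq → trans (sym lhs) (trans eq rhs))
      (λ eq → trans lhs (trans eq (sym rhs)))
      where
      lhs = cong (fun M f) (evals-initial-vars as b)
      rhs = lookup-∷ʳ-fromℕ as b

    module _ (P : Pred (Universe M) p) where
      open Equivalence using (to; from)

      preserved⇔closed : Preserved M (graphFormula {S = S} f) (const P) P ⇔ Closed M f P
      preserved⇔closed = mk⇔
        -- The element tested is the value `fun M f as` itself, which satisfies the graph formula by
        -- `refl`.
        (λ preserved as as∈P → preserved as as∈P (from (Image-graph as _) refl))
        (λ closed as as∈P {_} b∈ → subst P (to (Image-graph as _) b∈) (closed as as∈P))

      -- All components of the tuple are `P`, so the extra equalities hold by reflexivity.
      preserved⇔idempotent : Preserved M (graphFormula {S = S} f) (const P) P ⇔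
                             Idempotent M (graphFormula {S = S} f) (const P) P
      preserved⇔idempotent = mk⇔ (λ preserved → preserved , λ _ → ≐-refl) proj₁

      closed⇒subuniverse : Satisfiable P → Closed M f P →
                           IsUniverseOfSubstructure (restriction M f) P
      closed⇒subuniverse nonempty closed = B , ≐-refl
        where
        B : Substructure (restriction M f) _
        B = record
          { subset           = P
          ; nonempty         = nonempty
          -- The type of the closure proof forces the omitted value to be `fun M f (map proj₁ bs)`,
          -- which is why `subfun-restricts` is `refl`.
          ; subfun           = λ { only bs → _ , closed (map proj₁ bs) (lookup-map-proj₁-∈ bs) }
          ; subrel           = λ ()
          ; subfun-restricts = λ { only bs → refl }
          ; subrel-restricts = λ ()
          }

      subuniverse⇒closed : IsUniverseOfSubstructure (restriction M f) P → Closed M f P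
      subuniverse⇒closed (B , B⊆P , P⊆B) as as∈P =
        -- The value of the subalgebra operation carries its own membership proof; `value` moves
        -- that proof to `fun M f as`. The universe of `B` is only extensionally equal to `P`, so
        -- both inclusions are used to pass between them.
        B⊆P (subst (subset B) value (proj₂ (subfun B only bs)))
        where
        bs = attach {P = subset B} as (λ i → P⊆B (as∈P i))

        value : proj₁ (subfun B only bs) ≡ fun M f as
        value = trans (subfun-restricts B only bs) (cong (fun M f) (map-proj₁-attach as _))

      closed⇔subuniverse : Satisfiable P →
                           Closed M f P ⇔ IsUniverseOfSubstructure (restriction M f) P
      closed⇔subuniverse nonempty = mk⇔ (closed⇒subuniverse nonempty) subuniverse⇒closed

proposition4p2 : ∀ {s a p : Level} {S : Signature s} (M : Structure S a)
    {n : ℕ} (f : FunSym S n) (P : Pred (Universe M) p) → Satisfiable P →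
    (Preserved M (graphFormula {S = S} f) (const P) P
    ⇔ IsUniverseOfSubstructure (restriction M f) P)
    × (Idempotent M (graphFormula {S = S} f) (const P) P
    ⇔ IsUniverseOfSubstructure (restriction M f) P)
proposition4p2 M f P nonempty =
  preserved⇔subuniverse , preserved⇔subuniverse ⇔-∘ ⇔-sym (preserved⇔idempotent M f P)
  where
  preserved⇔subuniverse = closed⇔subuniverse M f P nonempty ⇔-∘ preserved⇔closed M f P
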